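{- For every fixed integer $k\ge 1$, there are only finitely many (up to isomorphism) $k$-vertex-critical $(P_5,\overline{P_3+P_2})$-free graphs.
   Context: All graphs are finite and simple. $P_t$ is the path on $t$ vertices; $G+H$ denotes the disjoint union of $G$ and $H$, and $\overline{G}$ the complement of $G$. Explicitly, $\overline{P_3+P_2}$ is the graph on vertices $a,b,c,d,e$ with edges $ac, da, db, dc, ea, eb, ec$ (a 4-cycle $a,d,c,e$ with chord $ac$... equivalently a 4-cycle with one chord plus a fifth vertex $b$ adjacent to the two ends $d,e$ of the non-chord diagonal). A graph $G$ is $H$-free if no induced subgraph of $G$ is isomorphic to $H$, and $(H_1,H_2)$-free if it is both $H_1$-free and $H_2$-free. $\chi(G)$ denotes the chromatic number. A graph $G$ is $k$-vertex-critical if $\chi(G)=k$ and $\chi(G-v)<k$ for every vertex $v\in V(G)$. -}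

module Defs where

open import Data.Nat using (ℕ; zero; suc; _<_; _≤_; _∸_)
open import Data.Fin using (Fin; zero; suc; _≟_; punchIn)
open import Data.Bool using (Bool; true; false; _∨_; if_then_else_)
open import Data.Bool.Properties using (∨-comm)
open import Data.Product using (Σ; ∃; _×_; _,_)
open import Data.List using (List)
open import Data.List.Membership.Propositional using (_∈_)
open import Relation.Nullary using (¬_; yes; no; does)
open import Relation.Binary.PropositionalEquality using (_≡_; _≢_; refl; sym)
open import Function.Definitions using (Injective)
open import Function.Bundles using (_↔_; Inverse)
open import Data.Empty using (⊥-elim)

record Graph (n : ℕ) : Set where
  field
    adj    : Fin n → Fin n → Bool
    adj-sym : ∀ i j → adj i j ≡ adj j i
    adj-irr : ∀ i → adj i i ≡ false
open Graph public

fromEdges : ∀ {n} → (Fin n → Fin n → Bool) → Graph n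
fromEdges {n} e = record { adj = a ; adj-sym = s ; adj-irr = r }
  where
  a : Fin n → Fin n → Bool
  a i j = if does (i ≟ j) then false else (e i j ∨ e j i)
  s : ∀ i j → a i j ≡ a j i
  s i j with i ≟ j | j ≟ i
  ... | yes _ | yes _ = refl
  ... | yes p | no q = ⊥-elim (q (sym p))
  ... | no q | yes p = ⊥-elim (q (sym p))
  ... | no _ | no _ = ∨-comm (e i j) (e j i)
  r : ∀ i → a i i ≡ false
  r i with i ≟ i
  ... | yes _ = refl
  ... | no q = ⊥-elim (q refl)

InducedSub : ∀ {m n} → Graph m → Graph n → Set
InducedSub {m} {n} H G =
  Σ (Fin m → Fin n) λ f → Injective _≡_ _≡_ f × (∀ i j → adj H i j ≡ adj G (f i) (f j))

Free : ∀ {m n} → Graph m → Graph n → Set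
Free H G = ¬ InducedSub H G

Iso : ∀ {m n} → Graph m → Graph n → Set
Iso {m} {n} G H =
  Σ (Fin m ↔ Fin n) λ φ → ∀ i j → adj G i j ≡ adj H (Inverse.to φ i) (Inverse.to φ j)

Colorable : ∀ {n} → Graph n → ℕ → Set
Colorable {n} G k =
  Σ (Fin n → Fin k) λ c → ∀ i j → adj G i j ≡ true → c i ≢ c j

ChromaticNumber : ∀ {n} → Graph n → ℕ → Set
ChromaticNumber G k = Colorable G k × (∀ m → Colorable G m → k ≤ m)

deleteVertex : ∀ {n} → Graph (suc n) → Fin (suc n) → Graph n
deleteVertex G v = record
  { adj = λ i j → adj G (punchIn v i) (punchIn v j)
  ; adj-sym = λ i j → adj-sym G (punchIn v i) (punchIn v j)
  ; adj-irr = λ i → adj-irr G (punchIn v i) }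

VertexCritical : ∀ {n} → ℕ → Graph n → Set
VertexCritical {zero} k G = ChromaticNumber G k
VertexCritical {suc n} k G =
  ChromaticNumber G k ×
  (∀ v → Σ ℕ λ m → ChromaticNumber (deleteVertex G v) m × m < k)

P5 : Graph 5
P5 = fromEdges e
  where
  e : Fin 5 → Fin 5 → Bool
  e zero (suc zero) = true
  e (suc zero) (suc (suc zero)) = true
  e (suc (suc zero)) (suc (suc (suc zero))) = true
  e (suc (suc (suc zero))) (suc (suc (suc (suc zero)))) = true
  e _ _ = false

-- complement of P3+P2 : vertices a,b,c,d,e = 0,1,2,3,4,
-- edges ac, da, db, dc, ea, eb, ec.
coP3P2 : Graph 5
coP3P2 = fromEdges e
  where
  e : Fin 5 → Fin 5 → Bool
  e zero (suc (suc zero)) = true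
  e (suc (suc (suc zero))) zero = true
  e (suc (suc (suc zero))) (suc zero) = true
  e (suc (suc (suc zero))) (suc (suc zero)) = true
  e (suc (suc (suc (suc zero)))) zero = true
  e (suc (suc (suc (suc zero)))) (suc zero) = true
  e (suc (suc (suc (suc zero)))) (suc (suc zero)) = true
  e _ _ = false

AnyGraph : Set
AnyGraph = Σ ℕ Graph

{-# OPTIONS --safe #-}

-- A k-vertex-critical graph has no clique cutset, and non-adjacent vertices have incomparable neighbourhoods.
-- With P5- and coP3P2-freeness these two facts bound the order.
--
-- Induced matchings are short: in a connected P5-free graph some clique dominates any given independent set,
-- so after deleting a clique S complete to a long induced matching, some vertex w sees many edges of the matching.
-- P5-freeness makes w complete to all but one of these, and coP3P2-freeness makes w complete to S, so S grows
-- while the matching remains long; but cliques have at most k vertices.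
--
-- Independent sets are small: incomparability yields x₁, x₂, … in a large independent set and y₁, y₂, … with
-- yᵢ ~ xᵢ and yᵢ ≁ xⱼ for i < j. By Ramsey this contains an induced matching or a half graph, and in a
-- half graph the vertices separating the xⱼ from the first x form an induced matching with every other xⱼ.
--
-- Hence every colour class, and with it the whole graph, has bounded size.
module Submission where

open import Defs
open import Data.Bool as Bool using (Bool; true; false)
open import Data.Bool.Properties using (∨-idem)
open import Data.Empty using (⊥; ⊥-elim)
open import Data.Fin as Fin
  using (Fin; zero; suc; punchOut; inject≤; finToFun; funToFin)
open import Data.Fin.Patterns using (3F; 4F)
open import Data.Fin.Permutation.Components using (transpose; transpose-inverse)
open import Data.Fin.Properties as Fin
  using (all?; <-cmp; punchIn-punchOut; inject≤-injective; finToFun-funToFin)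
open import Data.List using (List; []; _∷_; length; map; filter; tabulate; allFin; concatMap; upTo)
open import Data.List.Properties using (length-map; length-tabulate)
open import Data.List.Membership.Propositional using (_∈_; _∉_; find; lose)
open import Data.List.Membership.Propositional.Properties using (∈-filter⁺; ∈-allFin; ∈-upTo⁺)
open import Data.List.Relation.Binary.Sublist.Propositional
  using (_⊆_; []; _∷_; _∷ʳ_; ⊆-refl; ⊆-trans; minimum)
open import Data.List.Relation.Binary.Sublist.Propositional.Properties using (All-resp-⊆; Any-resp-⊆)
open import Data.List.Relation.Unary.All as All using (All; []; _∷_)
import Data.List.Relation.Unary.All.Properties as All
open import Data.List.Relation.Unary.AllPairs as AllPairs using (AllPairs; []; _∷_)
import Data.List.Relation.Unary.AllPairs.Properties as AllPairs
open import Data.List.Relation.Unary.Any as Any using (Any; here; there)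
import Data.List.Relation.Unary.Any.Properties as Any
open import Data.List.Relation.Unary.Unique.Propositional.Properties using (allFin⁺)
open import Data.Nat using (ℕ; _≤_; zero; suc; _+_; _*_; _^_; _<_; z≤n; s≤s; s≤s⁻¹)
open import Data.Nat.Properties
  using (≤-refl; ≤-trans; ≤-reflexive; <⇒≤; <⇒≱; ≮⇒≥; ≰⇒>; <-≤-trans; <-irrefl; <-asym; _<?_; _≤?_;
         n≤1+n; m≤n⇒m≤1+n; +-suc; +-identityʳ; +-monoˡ-≤; +-mono-<; +-cancelˡ-<; *-suc; *-identityʳ; *-monoʳ-≤)
open import Data.Product using (Σ; _×_; _,_; ∃; ∃₂; proj₁; proj₂; map₂)
open import Data.Sum using (_⊎_; inj₁; inj₂)
open import Data.Vec using ([]; _∷_; lookup)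
open import Function using (_∘_; id)
open import Function.Construct.Identity using (↔-id)
open import Function.Definitions using (Injective)
open import Relation.Binary.Definitions using (Symmetric; tri<; tri≈; tri>)
open import Relation.Binary.PropositionalEquality
  using (_≡_; _≢_; refl; sym; trans; cong; cong₂; subst)
open import Relation.Nullary using (Dec; yes; no; ¬_)
open import Relation.Nullary.Decidable
  using (¬?; _×-dec_; _⊎-dec_; _→-dec_; from-yes; dec-true; dec-false)
open import Relation.Unary using (Decidable)

-- Lists: sublists, pigeonhole and Ramsey.

AllPairs-resp-⊆ : ∀ {A : Set} {R : A → A → Set} {xs ys} →
                  xs ⊆ ys → AllPairs R ys → AllPairs R xs
AllPairs-resp-⊆ []         []       = []
AllPairs-resp-⊆ (_ ∷ʳ s)   (_ ∷ ps) = AllPairs-resp-⊆ s ps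
AllPairs-resp-⊆ (refl ∷ s) (p ∷ ps) = All-resp-⊆ s p ∷ AllPairs-resp-⊆ s ps

AllPairs-lookup : ∀ {A : Set} {R : A → A → Set} {xs x y} → Symmetric R →
                  AllPairs R xs → x ∈ xs → y ∈ xs → x ≢ y → R x y
AllPairs-lookup s (p ∷ _)  (here refl) (here refl) x≢y = ⊥-elim (x≢y refl)
AllPairs-lookup s (p ∷ _)  (here refl) (there j)   _   = All.lookup p j
AllPairs-lookup s (p ∷ _)  (there i)   (here refl) _   = s (All.lookup p i)
AllPairs-lookup s (_ ∷ ps) (there i)   (there j)   x≢y = AllPairs-lookup s ps i j x≢y

AllPairs-map-∈ : ∀ {A : Set} {R Q : A → A → Set} {xs} → (∀ {x y} → x ∈ xs → y ∈ xs → R x y → Q x y) →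
                 AllPairs R xs → AllPairs Q xs
AllPairs-map-∈ f [] = []
AllPairs-map-∈ f (p ∷ ps) = All.tabulate (λ i → f (here refl) (there i) (All.lookup p i)) ∷
  AllPairs-map-∈ (λ i j → f (there i) (there j)) ps

split : ∀ {A : Set} {P Q : A → Set} {xs} → All (λ x → P x ⊎ Q x) xs →
        ∃₂ λ ys zs → (ys ⊆ xs × All P ys) × (zs ⊆ xs × All Q zs) ×
                     length xs ≡ length ys + length zs
split [] = [] , [] , ([] , []) , ([] , []) , refl
split (inj₁ p ∷ ps) with split ps
... | ys , zs , (sy , py) , (sz , pz) , eq =
  _ ∷ ys , zs , (refl ∷ sy , p ∷ py) , (_ ∷ʳ sz , pz) , cong suc eq
split (inj₂ q ∷ ps) with split ps
... | ys , zs , (sy , py) , (sz , pz) , eq =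
  ys , _ ∷ zs , (_ ∷ʳ sy , py) , (refl ∷ sz , q ∷ pz) , trans (cong suc eq) (sym (+-suc _ _))

-- The classes may overlap, and `P j x` may hold data: callers put a vertex chosen for `x` into it,
-- so that the choice survives the passage to one class.
pigeonhole : ∀ {A : Set} k {P : Fin k → A → Set} m {xs} → All (λ x → ∃ λ j → P j x) xs →
             k * m < length xs → ∃₂ λ j ys → ys ⊆ xs × All (P j) ys × m < length ys
pigeonhole zero    m {x ∷ xs} ((() , _) ∷ _) _
pigeonhole (suc k) {P} m ps km< with split (All.map sort ps)
  where
  sort : ∀ {x} → (∃ λ j → P j x) → P zero x ⊎ ∃ λ j → P (suc j) x
  sort (zero  , p) = inj₁ p
  sort (suc j , p) = inj₂ (j , p)
... | ys , zs , (sy , py) , (sz , pz) , eq with m <? length ys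
...   | yes m< = zero , ys , sy , py , m<
...   | no m≮ with pigeonhole k m pz (+-cancelˡ-< m _ _ (<-≤-trans (subst (_ <_) eq km<) (+-monoˡ-≤ _ (≮⇒≥ m≮))))
...     | j , ws , sw , pw , m< = suc j , ws , ⊆-trans sw sz , pw , m<

ramseyBound : ℕ → ℕ → ℕ
ramseyBound zero    _       = 0
ramseyBound (suc a) zero    = 0
ramseyBound (suc a) (suc b) = suc (ramseyBound a (suc b) + ramseyBound (suc a) b)

-- Only pairs in list order are classified, so `R` and `Q` may be asymmetric.
ramsey : ∀ {A : Set} {R Q : A → A → Set} → (∀ x y → R x y ⊎ Q x y) → ∀ a b xs →
         ramseyBound a b ≤ length xs →
         (∃ λ ys → ys ⊆ xs × AllPairs R ys × a ≤ length ys) ⊎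
         (∃ λ ys → ys ⊆ xs × AllPairs Q ys × b ≤ length ys)
ramsey dec zero    b       xs _ = inj₁ ([] , minimum xs , [] , z≤n)
ramsey dec (suc a) zero    xs _ = inj₂ ([] , minimum xs , [] , z≤n)
ramsey dec (suc a) (suc b) (x ∷ xs) (s≤s le) with split (All.universal (dec x) xs)
... | ys , zs , (sy , py) , (sz , pz) , eq with ramseyBound a (suc b) ≤? length ys
...   | yes a≤ with ramsey dec a (suc b) ys a≤
...     | inj₁ (ws , sw , pw , l) = inj₁ (x ∷ ws , refl ∷ ⊆-trans sw sy , All-resp-⊆ sw py ∷ pw , s≤s l)
...     | inj₂ (ws , sw , pw , l) = inj₂ (ws , x ∷ʳ ⊆-trans sw sy , pw , l)
ramsey dec (suc a) (suc b) (x ∷ xs) (s≤s le)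
  | ys , zs , (sy , py) , (sz , pz) , eq | no a≰ with ramsey dec (suc a) b zs b≤
  where
  b≤ : ramseyBound (suc a) b ≤ length zs
  b≤ with ramseyBound (suc a) b ≤? length zs
  ... | yes b≤ = b≤
  ... | no b≰ = ⊥-elim (<⇒≱ (+-mono-< (≰⇒> a≰) (≰⇒> b≰)) (subst (_ ≤_) eq le))
... | inj₁ (ws , sw , pw , l) = inj₁ (ws , x ∷ʳ ⊆-trans sw sz , pw , l)
... | inj₂ (ws , sw , pw , l) = inj₂ (x ∷ ws , refl ∷ ⊆-trans sw sz , All-resp-⊆ sw pz ∷ pw , s≤s l)

attach : ∀ {A B : Set} {Q : A → B → Set} {R : A → A → Set} {xs} → All (λ x → ∃ (Q x)) xs → AllPairs R xs →
         ∃ λ ys → map proj₁ ys ≡ xs × All (λ y → Q (proj₁ y) (proj₂ y)) ys ×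
                  AllPairs (λ y z → R (proj₁ y) (proj₁ z)) ys
attach [] [] = [] , refl , [] , []
attach {xs = x ∷ _} ((b , q) ∷ qs) (r ∷ rs) with attach qs rs
... | ys , refl , qys , rys = (x , b) ∷ ys , refl , q ∷ qys , All.map⁻ r ∷ rys

-- Every other element is kept: the dropped successor `y` of a kept `x` helps to prove `T x z` for
-- every later kept `z`.
alternate : ∀ {A : Set} {P : A → Set} {R T : A → A → Set} →
            (∀ {x y z} → P x → P y → P z → R x y → R x z → R y z → T x z) →
            ∀ {xs} → All P xs → AllPairs R xs →
            ∃ λ ys → ys ⊆ xs × AllPairs T ys × length xs ≤ 2 * length ys
alternate f [] [] = [] , [] , [] , z≤n
alternate f (_ ∷ []) (_ ∷ []) = _ ∷ [] , refl ∷ [] , [] ∷ [] , s≤s z≤n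
alternate f {x ∷ y ∷ xs} (p ∷ q ∷ ps) ((r ∷ rs) ∷ rs′ ∷ rss) with alternate f ps rss
... | ys , s , t , l =
  x ∷ ys , refl ∷ y ∷ʳ s ,
  All-resp-⊆ s (All.zipWith (λ { (pz , xz , yz) → f p q pz r xz yz }) (ps , All.zip (rs , rs′))) ∷ t ,
  ≤-trans (s≤s (s≤s l)) (≤-reflexive (sym (*-suc 2 _)))

AllPairs-tabulate⁻ : ∀ {A : Set} {R : A → A → Set} {n} {f : Fin n → A} →
                     AllPairs R (tabulate f) → ∀ {i j} → i Fin.< j → R (f i) (f j)
AllPairs-tabulate⁻ (p ∷ _)  {zero}  {suc j} _   = All.tabulate⁻ p j
AllPairs-tabulate⁻ (_ ∷ ps) {suc i} {suc j} i<j = AllPairs-tabulate⁻ ps (s≤s⁻¹ i<j)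

-- Forbidden induced subgraphs as adjacency patterns.

SameRow : ∀ {n} → Graph n → Fin n → Fin n → Set
SameRow H i j = ∀ k → adj H i k ≡ adj H j k

-- By `same-row`, pattern vertices with equal images have equal rows. As the rows are distinct,
-- injectivity follows from the adjacencies.
P5-rows : ∀ i j → SameRow P5 i j → i ≡ j
P5-rows = from-yes (all? λ i → all? λ j → all? (λ k → adj P5 i k Bool.≟ adj P5 j k) →-dec i Fin.≟ j)

-- The vertices 3 and 4 are twins, hence the assumption `d ≢ e` in `no-coP3P2`.
coP3P2-rows : ∀ i j → SameRow coP3P2 i j → i ≡ j ⊎ (i ≡ 3F × j ≡ 4F ⊎ i ≡ 4F × j ≡ 3F)
coP3P2-rows = from-yes (all? λ i → all? λ j → all? (λ k → adj coP3P2 i k Bool.≟ adj coP3P2 j k) →-dec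
  (i Fin.≟ j ⊎-dec (i Fin.≟ 3F ×-dec j Fin.≟ 4F ⊎-dec i Fin.≟ 4F ×-dec j Fin.≟ 3F)))

module Patterns {n} (G : Graph n) where

  infix 4 _~_ _≁_

  _~_ _≁_ : Fin n → Fin n → Set
  u ~ v = adj G u v ≡ true
  u ≁ v = adj G u v ≡ false

  ~-sym : ∀ {u v} → u ~ v → v ~ u
  ~-sym {u} {v} = trans (adj-sym G v u)

  ≁-sym : ∀ {u v} → u ≁ v → v ≁ u
  ≁-sym {u} {v} = trans (adj-sym G v u)

  ~-≁-contra : ∀ {u v} → u ~ v → u ≁ v → ⊥
  ~-≁-contra p q with trans (sym p) q
  ... | ()

  ~-irrefl : ∀ {u} → ¬ u ~ u
  ~-irrefl {u} p = ~-≁-contra p (adj-irr G u)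

  adj? : ∀ u v → u ~ v ⊎ u ≁ v
  adj? u v with adj G u v
  ... | true  = inj₁ refl
  ... | false = inj₂ refl

  Agrees : ∀ {m} → Graph m → (Fin m → Fin n) → Fin m → Fin m → Set
  Agrees H f i j = adj H i j ≡ adj G (f i) (f j)

  agrees-everywhere : ∀ {m} (H : Graph m) f → AllPairs (Agrees H f) (allFin m) → ∀ i j → Agrees H f i j
  agrees-everywhere H f ps i j with <-cmp i j
  ... | tri< i<j _ _ = AllPairs-tabulate⁻ ps i<j
  ... | tri≈ _ refl _ = trans (adj-irr H i) (sym (adj-irr G (f i)))
  ... | tri> _ _ j<i = trans (adj-sym H i j) (trans (AllPairs-tabulate⁻ ps j<i) (adj-sym G (f j) (f i)))

  same-row : ∀ {m} (H : Graph m) f → (∀ i j → Agrees H f i j) → ∀ i j → f i ≡ f j → SameRow H i j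
  same-row H f h i j eq k = trans (h i k) (trans (cong (λ v → adj G v (f k)) eq) (sym (h j k)))

  no-P5 : Free P5 G → ∀ {a b c d e} → a ~ b → b ~ c → c ~ d → d ~ e →
          a ≁ c → a ≁ d → a ≁ e → b ≁ d → b ≁ e → c ≁ e → ⊥
  no-P5 free {a} {b} {c} {d} {e} ab bc cd de ac ad ae bd be ce =
    free (f , (λ {i} {j} eq → P5-rows i j (same-row P5 f h i j eq)) , h)
    where
    f = lookup (a ∷ b ∷ c ∷ d ∷ e ∷ [])
    h = agrees-everywhere P5 f
      ((sym ab ∷ sym ac ∷ sym ad ∷ sym ae ∷ []) ∷ (sym bc ∷ sym bd ∷ sym be ∷ []) ∷
       (sym cd ∷ sym ce ∷ []) ∷ (sym de ∷ []) ∷ [] ∷ [])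

  no-coP3P2 : Free coP3P2 G → ∀ {a b c d e} → d ≢ e → d ≁ e →
              a ~ c → a ≁ b → b ≁ c → d ~ a → d ~ b → d ~ c → e ~ a → e ~ b → e ~ c → ⊥
  no-coP3P2 free {a} {b} {c} {d} {e} d≢e de ac ab bc da db dc ea eb ec =
    free (f , inj , h)
    where
    f = lookup (a ∷ b ∷ c ∷ d ∷ e ∷ [])
    h = agrees-everywhere coP3P2 f
      ((sym ab ∷ sym ac ∷ sym (~-sym da) ∷ sym (~-sym ea) ∷ []) ∷
       (sym bc ∷ sym (~-sym db) ∷ sym (~-sym eb) ∷ []) ∷
       (sym (~-sym dc) ∷ sym (~-sym ec) ∷ []) ∷ (sym de ∷ []) ∷ [] ∷ [])
    inj : ∀ {i j} → f i ≡ f j → i ≡ j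
    inj {i} {j} eq with coP3P2-rows i j (same-row coP3P2 f h i j eq)
    ... | inj₁ i≡j = i≡j
    ... | inj₂ (inj₁ (refl , refl)) = ⊥-elim (d≢e eq)
    ... | inj₂ (inj₂ (refl , refl)) = ⊥-elim (d≢e (sym eq))

-- Numerical bounds.

-- `t` is the number of vertices that a clique lacks to have order `k + 1`. The summand 2 keeps the
-- bound at least 2, as `complete-to-clique` requires.
matchingBound : ℕ → ℕ → ℕ
matchingBound k zero    = 2
matchingBound k (suc t) = 2 + k * matchingBound k t

2≤matchingBound : ∀ k t → 2 ≤ matchingBound k t
2≤matchingBound k zero    = ≤-refl
2≤matchingBound k (suc t) = s≤s (s≤s z≤n)

-- The summand 2 counts the vertex taken off the list and one more that makes the pigeonhole
-- inequality strict.
staircaseBound : ℕ → ℕ → ℕ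
staircaseBound k zero    = 0
staircaseBound k (suc l) = 2 + k * staircaseBound k l

-- Each factor `k` pays for passing to one colour class, the factor 2 for `alternate`. The summand 2
-- in `staircaseLength` counts the reference pair of the half graph and one pair too many.
matchingLimit halfGraphLimit staircaseLength independentLimit : ℕ → ℕ
matchingLimit k    = matchingBound k (suc k)
halfGraphLimit k   = 2 * (k * matchingLimit k)
staircaseLength k  = suc (k * ramseyBound (2 + halfGraphLimit k) (matchingLimit k))
independentLimit k = staircaseBound k (staircaseLength k)

-- Opaque, since unfolding this tower of bounds makes type checking explode.
opaque
  orderLimit : ℕ → ℕ
  orderLimit k = k * independentLimit k

-- Dominating cliques outside a deleted set.

module Structure {n} (G : Graph n) (P5-free : Free P5 G) (coP3P2-free : Free coP3P2 G) where

  open Patterns G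
  open import Data.List.Membership.DecPropositional (Fin._≟_ {n}) using (_∈?_)

  noP5 = no-P5 P5-free
  noH = no-coP3P2 coP3P2-free

  _~?_ : ∀ u v → Dec (u ~ v)
  u ~? v = adj G u v Bool.≟ true

  Clique : List (Fin n) → Set
  Clique = AllPairs _~_

  Clique-lookup : ∀ {S u v} → Clique S → u ∈ S → v ∈ S → u ≢ v → u ~ v
  Clique-lookup = AllPairs-lookup ~-sym

  Touches : List (Fin n) → Fin n → Set
  Touches D v = Any (_~ v) D

  ¬Touches⇒≁ : ∀ {D v d} → ¬ Touches D v → d ∈ D → d ≁ v
  ¬Touches⇒≁ {v = v} {d} ¬t d∈D with adj? d v
  ... | inj₁ d~v = ⊥-elim (¬t (lose d∈D d~v))
  ... | inj₂ d≁v = d≁v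

  -- Connectivity of the graph minus `S`, by cuts instead of paths: a decidable set that splits the
  -- remaining vertices is left by an edge. Recolouring proves this form directly.
  Connected∖ : List (Fin n) → Set₁
  Connected∖ S = ∀ {P : Fin n → Set} → Decidable P →
    ∀ {a b} → a ∉ S → P a → b ∉ S → ¬ P b →
    ∃₂ λ u v → (u ∉ S × v ∉ S) × (P u × ¬ P v) × u ~ v

  module _ (S : List (Fin n)) (connected : Connected∖ S) where

    Within₂ Within₃ Within : List (Fin n) → Fin n → Set
    Within₂ D v = ∃ λ u → (u ∉ S × Touches D u) × u ~ v
    Within₃ D v = ∃ λ u → (u ∉ S × Within₂ D u) × u ~ v
    Within D v = v ∈ D ⊎ Touches D v ⊎ Within₂ D v ⊎ Within₃ D v

    within₂? : ∀ D → Decidable (Within₂ D)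
    within₂? D v = Fin.any? λ u → (¬? (u ∈? S) ×-dec Any.any? (_~? u) D) ×-dec u ~? v

    within? : ∀ D → Decidable (Within D)
    within? D v = v ∈? D ⊎-dec Any.any? (_~? v) D ⊎-dec within₂? D v ⊎-dec
      Fin.any? λ u → (¬? (u ∈? S) ×-dec within₂? D u) ×-dec u ~? v

    -- A vertex just outside the ball of radius 3 would be the end of an induced P5.
    everything-within : ∀ {D d v} → All (_∉ S) D → d ∈ D → v ∉ S → Within D v
    everything-within {D} {d} {v} D∉S d∈D v∉S with within? D v
    ... | yes w = w
    ... | no ¬w with connected (within? D) (All.lookup D∉S d∈D) (inj₁ d∈D) v∉S ¬w
    ...   | u , t , (u∉S , _) , (inj₁ u∈D , ¬wt) , u~t = ⊥-elim (¬wt (inj₂ (inj₁ (lose u∈D u~t))))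
    ...   | u , t , (u∉S , _) , (inj₂ (inj₁ tu) , ¬wt) , u~t =
            ⊥-elim (¬wt (inj₂ (inj₂ (inj₁ (u , (u∉S , tu) , u~t)))))
    ...   | u , t , (u∉S , _) , (inj₂ (inj₂ (inj₁ wu)) , ¬wt) , u~t =
            ⊥-elim (¬wt (inj₂ (inj₂ (inj₂ (u , (u∉S , wu) , u~t)))))
    ...   | u₃ , t , (u₃∉S , _) , (inj₂ (inj₂ (inj₂ (u₂ , (u₂∉S , u₁ , (u₁∉S , tu₁) , u₁~u₂) , u₂~u₃))) , ¬wt) , u₃~t
            with find tu₁
    ...     | d′ , d′∈D , d′~u₁ = ⊥-elim (noP5 d′~u₁ u₁~u₂ u₂~u₃ u₃~t
              (¬Touches⇒≁ ¬tu₂ d′∈D)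
              (¬Touches⇒≁ (λ tu₃ → ¬wt (inj₂ (inj₂ (inj₁ (u₃ , (u₃∉S , tu₃) , u₃~t))))) d′∈D)
              (¬Touches⇒≁ (λ tt → ¬wt (inj₂ (inj₁ tt))) d′∈D)
              (not (λ u₁~u₃ → ¬wt (inj₂ (inj₂ (inj₂ (u₃ , (u₃∉S , u₁ , (u₁∉S , tu₁) , u₁~u₃) , u₃~t))))))
              (not (λ u₁~t → ¬wt (inj₂ (inj₂ (inj₁ (u₁ , (u₁∉S , tu₁) , u₁~t))))))
              (not (λ u₂~t → ¬wt (inj₂ (inj₂ (inj₂ (u₂ , (u₂∉S , u₁ , (u₁∉S , tu₁) , u₁~u₂) , u₂~t)))))))
      where
      not : ∀ {x y} → ¬ x ~ y → x ≁ y
      not {x} {y} ¬xy with adj? x y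
      ... | inj₁ xy = ⊥-elim (¬xy xy)
      ... | inj₂ x≁y = x≁y
      ¬tu₂ : ¬ Touches D u₂
      ¬tu₂ tu₂ = ¬wt (inj₂ (inj₂ (inj₂ (u₃ , (u₃∉S , u₂ , (u₂∉S , tu₂) , u₂~u₃) , u₃~t))))

    Dominating : List (Fin n) → List (Fin n) → Set
    Dominating I D = Clique D × All (_∉ S) D × All (Touches D) I

    -- By `everything-within`, `x` is two or three steps away from `D`. Either some neighbour of `x`
    -- touches `D`, or the two inner vertices of a walk of length three take over. The vertex `r`
    -- ensures that `D` is non-empty.
    dominate-one-more : ∀ {x D r I} → x ∉ S → ¬ Touches D x → All (x ≁_) (r ∷ I) →
                        Dominating (r ∷ I) D → ∃ (Dominating (x ∷ r ∷ I))
    dominate-one-more {x} {D} {r} {I} x∉S ¬tx x≁I (DC , D∉S , tr ∷ tI) = extend (find tr)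
      where
      touched : All (λ s → x ≁ s × ∃ λ d → d ∈ D × d ~ s) (r ∷ I)
      touched = All.zipWith (map₂ find) (x≁I , tr ∷ tI)

      -- `u` replaces the members of `D` that it misses. An uncovered `s` would give the induced
      -- path `s`, `d′`, `d`, `u`, `x`.
      at-distance-2 : ∀ {u} → u ∉ S → Touches D u → u ~ x → ∃ (Dominating (x ∷ r ∷ I))
      at-distance-2 {u} u∉S tu u~x with find tu
      ... | d , d∈D , d~u =
        D′ ,
        All.all-filter (u ~?_) D ∷ AllPairs.filter⁺ (u ~?_) DC ,
        u∉S ∷ All.filter⁺ (u ~?_) D∉S ,
        here u~x ∷ All.map cover touched
        where
        D′ = u ∷ filter (u ~?_) D
        keep : ∀ {d′ s} → d′ ∈ D → u ~ d′ → d′ ~ s → Touches D′ s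
        keep d′∈D u~d′ d′~s = there (lose (∈-filter⁺ (u ~?_) d′∈D u~d′) d′~s)
        cover : ∀ {s} → x ≁ s × (∃ λ d′ → d′ ∈ D × d′ ~ s) → Touches D′ s
        cover {s} (x≁s , d′ , d′∈D , d′~s) with adj? u s | adj? u d′ | adj? d s
        ... | inj₁ u~s | _         | _        = here u~s
        ... | inj₂ _   | inj₁ u~d′ | _        = keep d′∈D u~d′ d′~s
        ... | inj₂ _   | inj₂ _    | inj₁ d~s = keep d∈D (~-sym d~u) d~s
        ... | inj₂ u≁s | inj₂ u≁d′ | inj₂ d≁s = ⊥-elim (noP5
              (~-sym d′~s) (Clique-lookup DC d′∈D d∈D λ { refl → ~-≁-contra d~u (≁-sym u≁d′) })
              d~u u~x (≁-sym d≁s) (≁-sym u≁s) (≁-sym x≁s) (≁-sym u≁d′)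
              (¬Touches⇒≁ ¬tx d′∈D) (¬Touches⇒≁ ¬tx d∈D))

      -- An uncovered `s` starts an induced P5 through `u₁`, `u₂`, `x` if `d` or `d′` sees both `s`
      -- and `u₁`; otherwise `s`, `d′`, `d`, `u₁`, `u₂` is one.
      at-distance-3 : ∀ {u₁ u₂} → u₁ ∉ S → u₂ ∉ S → Touches D u₁ → ¬ Touches D u₂ →
                      u₁ ~ u₂ → u₂ ~ x → u₁ ≁ x → ∃ (Dominating (x ∷ r ∷ I))
      at-distance-3 {u₁} {u₂} u₁∉S u₂∉S tu₁ ¬tu₂ u₁~u₂ u₂~x u₁≁x with find tu₁
      ... | d , d∈D , d~u₁ =
        u₁ ∷ u₂ ∷ [] ,
        (u₁~u₂ ∷ []) ∷ [] ∷ [] ,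
        u₁∉S ∷ u₂∉S ∷ [] ,
        there (here u₂~x) ∷ All.map cover touched
        where
        via : ∀ {d s} → x ≁ s → u₁ ≁ s → u₂ ≁ s → d ∈ D → d ~ s → d ~ u₁ → ⊥
        via x≁s u₁≁s u₂≁s d∈D d~s d~u₁ = noP5
          (~-sym d~s) d~u₁ u₁~u₂ u₂~x (≁-sym u₁≁s) (≁-sym u₂≁s) (≁-sym x≁s)
          (¬Touches⇒≁ ¬tu₂ d∈D) (¬Touches⇒≁ ¬tx d∈D) u₁≁x
        cover : ∀ {s} → x ≁ s × (∃ λ d′ → d′ ∈ D × d′ ~ s) → Touches (u₁ ∷ u₂ ∷ []) s
        cover {s} (x≁s , d′ , d′∈D , d′~s) with adj? u₁ s | adj? u₂ s | adj? d′ u₁ | adj? d s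
        ... | inj₁ u₁~s | _         | _          | _        = here u₁~s
        ... | inj₂ _    | inj₁ u₂~s | _          | _        = there (here u₂~s)
        ... | inj₂ u₁≁s | inj₂ u₂≁s | inj₁ d′~u₁ | _        = ⊥-elim (via x≁s u₁≁s u₂≁s d′∈D d′~s d′~u₁)
        ... | inj₂ u₁≁s | inj₂ u₂≁s | inj₂ _     | inj₁ d~s = ⊥-elim (via x≁s u₁≁s u₂≁s d∈D d~s d~u₁)
        ... | inj₂ u₁≁s | inj₂ u₂≁s | inj₂ d′≁u₁ | inj₂ d≁s = ⊥-elim (noP5
              (~-sym d′~s) (Clique-lookup DC d′∈D d∈D λ { refl → ~-≁-contra d~u₁ d′≁u₁ })
              d~u₁ u₁~u₂ (≁-sym d≁s) (≁-sym u₁≁s) (≁-sym u₂≁s) d′≁u₁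
              (¬Touches⇒≁ ¬tu₂ d′∈D) (¬Touches⇒≁ ¬tu₂ d∈D))

      extend : (∃ λ d → d ∈ D × d ~ r) → ∃ (Dominating (x ∷ r ∷ I))
      extend (d , d∈D , d~r) with everything-within D∉S d∈D x∉S
      ... | inj₁ x∈D =
        ⊥-elim (¬tx (lose d∈D (Clique-lookup DC d∈D x∈D λ { refl → ~-≁-contra d~r (All.head x≁I) })))
      ... | inj₂ (inj₁ tx) = ⊥-elim (¬tx tx)
      ... | inj₂ (inj₂ (inj₁ (u , (u∉S , tu) , u~x))) = at-distance-2 u∉S tu u~x
      ... | inj₂ (inj₂ (inj₂ (u₂ , (u₂∉S , u₁ , (u₁∉S , tu₁) , u₁~u₂) , u₂~x)))
        with adj? u₁ x | Any.any? (_~? u₂) D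
      ...   | inj₁ u₁~x | _       = at-distance-2 u₁∉S tu₁ u₁~x
      ...   | inj₂ _    | yes tu₂ = at-distance-2 u₂∉S tu₂ u₂~x
      ...   | inj₂ u₁≁x | no ¬tu₂ = at-distance-3 u₁∉S u₂∉S tu₁ ¬tu₂ u₁~u₂ u₂~x u₁≁x

    dominating-clique : ∀ {I} → AllPairs _≁_ I → All (_∉ S) I →
                        All (λ x → ∃ λ y → y ∉ S × y ~ x) I → ∃ (Dominating I)
    dominating-clique [] [] [] = [] , [] , [] , []
    dominating-clique ([] ∷ []) (_ ∷ []) ((y , y∉S , y~x) ∷ []) =
      y ∷ [] , [] ∷ [] , y∉S ∷ [] , here y~x ∷ []
    dominating-clique {x ∷ _ ∷ _} (x≁I@(_ ∷ _) ∷ I≁) (x∉S ∷ I∉S) (_ ∷ ys) with dominating-clique I≁ I∉S ys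
    ... | D , DC , D∉S , tI with Any.any? (_~? x) D
    ...   | yes tx = D , DC , D∉S , tx ∷ tI
    ...   | no ¬tx = dominate-one-more x∉S ¬tx x≁I (DC , D∉S , tI)

  -- Induced matchings and cliques complete to them.

  record Independent (p q : Fin n × Fin n) : Set where
    constructor indep
    field
      xx : proj₁ p ≁ proj₁ q
      xy : proj₁ p ≁ proj₂ q
      yx : proj₂ p ≁ proj₁ q
      yy : proj₂ p ≁ proj₂ q
  open Independent

  Edge : Fin n × Fin n → Set
  Edge (x , y) = x ~ y

  InducedMatching : List (Fin n × Fin n) → Set
  InducedMatching M = All Edge M × AllPairs Independent M

  Complete : Fin n → Fin n × Fin n → Set
  Complete w (x , y) = w ~ x × w ~ y

  -- If `w` missed both `y` and `y′`, then `y`, `x`, `w`, `x′`, `y′` would be an induced P5.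
  mixed-on-at-most-one : ∀ {w M} → InducedMatching M → All (λ p → w ~ proj₁ p) M →
                         ∃ λ M′ → M′ ⊆ M × All (Complete w) M′ × length M ≤ suc (length M′)
  mixed-on-at-most-one ([] , []) [] = [] , [] , [] , z≤n
  mixed-on-at-most-one {w} {(x , y) ∷ M} (e ∷ es , i ∷ is) (wx ∷ wxs) with adj? w y
  ... | inj₁ wy with mixed-on-at-most-one (es , is) wxs
  ...   | M′ , s , c , l = (x , y) ∷ M′ , refl ∷ s , (wx , wy) ∷ c , s≤s l
  mixed-on-at-most-one {w} {(x , y) ∷ M} (e ∷ es , i ∷ is) (wx ∷ wxs)
    | inj₂ w≁y = M , (_ ∷ʳ ⊆-refl) , All.zipWith complete (All.zip (es , i) , wxs) , ≤-refl
    where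
    complete : ∀ {q} → (Edge q × Independent (x , y) q) × w ~ proj₁ q → Complete w q
    complete {x′ , y′} ((e′ , i′) , wx′) with adj? w y′
    ... | inj₁ wy′ = wx′ , wy′
    ... | inj₂ w≁y′ = ⊥-elim (noP5 (~-sym e) (~-sym wx) wx′ e′ (≁-sym w≁y) (yx i′) (yy i′) (xx i′) (xy i′) w≁y′)

  -- Otherwise `d`, `e`, both ends of `p` and the first end of `q` induce `coP3P2`.
  common-neighbours-adjacent : ∀ {d e p q M} → InducedMatching (p ∷ q ∷ M) → d ≢ e →
    Complete d p → Complete d q → Complete e p → Complete e q → d ~ e
  common-neighbours-adjacent {d} {e} (pe ∷ _ , (i ∷ _) ∷ _) d≢e (dx , dy) (dx′ , _) (ex , ey) (ex′ , _)
    with adj? d e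
  ... | inj₁ d~e = d~e
  ... | inj₂ d≁e = ⊥-elim (noH d≢e d≁e pe (xx i) (≁-sym (yx i)) dx dx′ dy ex ex′ ey)

  AllComplete : List (Fin n) → List (Fin n × Fin n) → Set
  AllComplete S = All (λ p → All (λ s → Complete s p) S)

  outside : ∀ {S p} → All (λ s → Complete s p) S → proj₁ p ∉ S × proj₂ p ∉ S
  outside {p = x , y} c =
    (λ x∈S → ~-irrefl {x} (proj₁ (All.lookup c x∈S))) , (λ y∈S → ~-irrefl {y} (proj₂ (All.lookup c y∈S)))

  complete-to-clique : ∀ {w S M} → InducedMatching M → 2 ≤ length M → w ∉ S →
                       All (Complete w) M → AllComplete S M → All (w ~_) S
  complete-to-clique im (s≤s (s≤s _)) w∉S (c ∷ c′ ∷ _) (d ∷ d′ ∷ _) = All.tabulate λ u∈S →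
    common-neighbours-adjacent im (λ { refl → w∉S u∈S }) c c′ (All.lookup d u∈S) (All.lookup d′ u∈S)

  -- Half graphs.

  -- For a list of edges, `AllPairs Half` describes an induced half graph: both sides are
  -- independent, and the i-th `x` sees the j-th `y` exactly when i ≤ j.
  record Half (p q : Fin n × Fin n) : Set where
    constructor half
    field
      hxx : proj₁ p ≁ proj₁ q
      hyx : proj₂ p ≁ proj₁ q
      hyy : proj₂ p ≁ proj₂ q
      hxy : proj₁ p ~ proj₂ q
  open Half

  -- If z saw both x and x′, P5-freeness would make z adjacent to y and y′, and then x, z, x₀, y, y′ induce coP3P2.
  half-graph-obstruction : ∀ {x₀ x x′ y y′ z} → x₀ ≁ x → x₀ ≁ x′ → x ≁ x′ →
    y ≢ y′ → y ≁ y′ → x₀ ~ y → x₀ ~ y′ → x ~ y → x ~ y′ → y ≁ x′ → y′ ≁ x′ →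
    z ≁ x₀ → z ~ x → z ≁ x′
  half-graph-obstruction {x₀} {x} {x′} {y} {y′} {z} x₀x x₀x′ xx′ y≢y′ yy′ x₀y x₀y′ xy xy′ yx′ y′x′ zx₀ zx
    with adj? z x′
  ... | inj₂ z≁x′ = z≁x′
  ... | inj₁ zx′ = ⊥-elim (noH y≢y′ yy′ (~-sym zx) (≁-sym x₀x) (≁-sym zx₀)
          (~-sym xy) (~-sym x₀y) (crossing x₀y xy yx′) (~-sym xy′) (~-sym x₀y′) (crossing x₀y′ xy′ y′x′))
    where
    crossing : ∀ {y} → x₀ ~ y → x ~ y → y ≁ x′ → y ~ z
    crossing {y} x₀y xy yx′ with adj? y z
    ... | inj₁ y~z = y~z
    ... | inj₂ y≁z = ⊥-elim (noP5 x₀y (~-sym xy) (~-sym zx) zx′ x₀x (≁-sym zx₀) x₀x′ y≁z yx′ xx′)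

  -- Bounds in terms of the number of colours.

  module _ {k} (col : Fin n → Fin k) (proper : ∀ i j → i ~ j → col i ≢ col j)
    (connected : ∀ S → Clique S → Connected∖ S)
    (separate : ∀ u v → u ≢ v → u ≁ v → ∃ λ w → w ~ u × w ≁ v)
    where

    same-colour⇒≁ : ∀ {u v j} → col u ≡ j → col v ≡ j → u ≁ v
    same-colour⇒≁ {u} {v} eu ev with adj? u v
    ... | inj₁ u~v = ⊥-elim (proper u v u~v (trans eu (sym ev)))
    ... | inj₂ u≁v = u≁v

    clique-size : ∀ {S} → Clique S → length S ≤ k
    clique-size {S} SC = ≮⇒≥ λ k< →
      two-same (pigeonhole k 1 {S} (All.universal (λ u → col u , refl) S) (subst (_< length S) (sym (*-identityʳ k)) k<))
      where
      two-same : ¬ ∃₂ λ j ys → ys ⊆ S × All (λ u → col u ≡ j) ys × 1 < length ys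
      two-same (j , _ ∷ [] , _ , _ , s≤s ())
      two-same (j , u ∷ v ∷ _ , s , eu ∷ ev ∷ _ , _) with AllPairs-resp-⊆ s SC
      ... | (u~v ∷ _) ∷ _ = ~-≁-contra u~v (same-colour⇒≁ eu ev)

    -- A colour determines a vertex of the clique `D`, so pigeonholing on the colours of dominating
    -- vertices singles out one vertex.
    popular-neighbour : ∀ {D} {M : List (Fin n × Fin n)} m → Clique D →
      All (Touches D ∘ proj₁) M → k * m < length M →
      ∃₂ λ w M′ → w ∈ D × M′ ⊆ M × All (λ p → w ~ proj₁ p) M′ × m < length M′
    popular-neighbour {D} m DC tM km<
      with pigeonhole k {λ j p → ∃ λ d → d ∈ D × d ~ proj₁ p × col d ≡ j} m
             (All.map (λ t → let d , d∈D , d~x = find t in col d , d , d∈D , d~x , refl) tM) km<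
    ... | j , p ∷ M′ , s , (w , w∈D , w~x , cw) ∷ ps , m< =
      w , p ∷ M′ , w∈D , s , w~x ∷ All.map same ps , m<
      where
      same : ∀ {x} → (∃ λ d → d ∈ D × d ~ x × col d ≡ j) → w ~ x
      same (d , d∈D , d~x , cd) with w Fin.≟ d
      ... | yes refl = d~x
      ... | no w≢d = ⊥-elim (~-≁-contra (Clique-lookup DC w∈D d∈D w≢d) (same-colour⇒≁ cw cd))

    -- At `t = 0` the clique `S` would have `k + 1` vertices. Otherwise a popular vertex of a clique
    -- dominating the first ends moves into `S`, which lowers `t`.
    no-long-matching : ∀ t {S M} → length S + t ≡ suc k → Clique S → InducedMatching M →
                       AllComplete S M → ¬ matchingBound k t ≤ length M
    no-long-matching zero {S} eq SC _ _ _ =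
      <⇒≱ (≤-reflexive (sym (trans (sym (+-identityʳ _)) eq))) (clique-size SC)
    no-long-matching (suc t) {S} {M} eq SC (es , is) cM b≤ = grow
      (dominating-clique S (connected S SC) (AllPairs.map⁺ (AllPairs.map xx is))
        (All.map⁺ (All.map (proj₁ ∘ outside) cM))
        -- The neighbour outside `S` required for a first end is its partner in the matching.
        (All.map⁺ (All.zipWith (λ (c , e) → _ , proj₂ (outside c) , ~-sym e) (cM , es))))
      where
      grow : ¬ ∃ (Dominating S (connected S SC) (map proj₁ M))
      grow (D , DC , D∉S , tM) with popular-neighbour (matchingBound k t) DC (All.map⁻ tM) (≤-trans (n≤1+n _) b≤)
      ... | w , M′ , w∈D , s′ , wM′ , m<
        with mixed-on-at-most-one (All-resp-⊆ s′ es , AllPairs-resp-⊆ s′ is) wM′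
      ...   | M″ , s″ , cw , l = no-long-matching t (trans (sym (+-suc _ _)) eq)
          (complete-to-clique im″ (≤-trans (2≤matchingBound k t) b≤′) (All.lookup D∉S w∈D) cw cM″ ∷ SC)
          im″ (All.zipWith (λ (a , b) → a ∷ b) (cw , cM″)) b≤′
        where
        s = ⊆-trans s″ s′
        im″ : InducedMatching M″
        im″ = All-resp-⊆ s es , AllPairs-resp-⊆ s is
        cM″ = All-resp-⊆ s cM
        -- The strict inequality from the pigeonhole pays for the one edge on which `w` may be
        -- mixed.
        b≤′ : matchingBound k t ≤ length M″
        b≤′ = s≤s⁻¹ (≤-trans m< l)

    matching-short : ∀ {M} → InducedMatching M → length M < matchingLimit k
    matching-short im = ≰⇒> (no-long-matching (suc k) refl [] im (All.universal (λ _ → []) _))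

    -- By P5-freeness, neighbours of x of one colour have nested neighbourhoods in zs; the smallest one is empty.
    avoid : ∀ {x j z zs} → All (x ≁_) (z ∷ zs) → AllPairs _≁_ (z ∷ zs) →
            All (λ z → ∃ λ y → (y ~ x × y ≁ z) × col y ≡ j) (z ∷ zs) →
            ∃ λ y → (y ~ x × All (y ≁_) (z ∷ zs)) × col y ≡ j
    avoid {zs = []} _ _ ((y , (y~x , y≁z) , c) ∷ []) = y , (y~x , y≁z ∷ []) , c
    avoid {x} {j} {z} {z′ ∷ zs} (x≁z ∷ x≁) (z≁ ∷ ≁s) ((y′ , (y′~x , y′≁z) , c′) ∷ ys) with avoid x≁ ≁s ys
    ... | y , (y~x , y≁) , c with adj? y z
    ...   | inj₂ y≁z = y , (y~x , y≁z ∷ y≁) , c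
    ...   | inj₁ y~z = y′ , (y′~x , y′≁z ∷ All.zipWith nested (y≁ , All.zip (x≁ , z≁))) , c′
      where
      nested : ∀ {r} → y ≁ r × (x ≁ r × z ≁ r) → y′ ≁ r
      nested {r} (y≁r , x≁r , z≁r) with adj? y′ r
      ... | inj₂ y′≁r = y′≁r
      ... | inj₁ y′~r = ⊥-elim (noP5 (~-sym y~z) y~x (~-sym y′~x) y′~r
              (≁-sym x≁z) (≁-sym y′≁z) z≁r (same-colour⇒≁ c c′) y≁r x≁r)

    Step : Fin n × Fin n → Fin n × Fin n → Set
    Step p q = proj₁ p ≁ proj₁ q × proj₂ p ≁ proj₁ q

    -- For each later `v` the first `x` has a neighbour that misses `v`. Within a frequent colour of
    -- these neighbours `avoid` replaces them by a single `y`, and the recursion stays in that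
    -- class. Membership in `I` is returned so that `x` and `y` miss all later first ends.
    staircase : ∀ l {I} → AllPairs (λ u v → u ≢ v × u ≁ v) I → staircaseBound k l ≤ length I →
                ∃ λ ps → All Edge ps × AllPairs Step ps × All (λ p → proj₁ p ∈ I) ps × length ps ≡ l
    staircase zero _ _ = [] , [] , [] , [] , refl
    staircase (suc l) {x ∷ I} (x# ∷ I#) (s≤s b<)
      with pigeonhole k {λ j v → ∃ λ y → (y ~ x × y ≁ v) × col y ≡ j} (staircaseBound k l)
             (All.map (λ { {v} (x≢v , x≁v) → let y , r = separate x v x≢v x≁v in col y , y , r , refl }) x#) b<
    ... | j , z ∷ zs , s , ys , m<
      with avoid (All.map proj₂ (All-resp-⊆ s x#)) (AllPairs.map proj₂ (AllPairs-resp-⊆ s I#)) ys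
         | staircase l (AllPairs-resp-⊆ s I#) (<⇒≤ m<)
    ... | y , (y~x , y≁) , _ | ps , es , st , ∈zs , len =
      (x , y) ∷ ps , ~-sym y~x ∷ es ,
      All.map (λ i → All.lookup (All.map proj₂ (All-resp-⊆ s x#)) i , All.lookup y≁ i) ∈zs ∷ st ,
      here refl ∷ All.map (λ i → there (Any-resp-⊆ s i)) ∈zs , cong suc len

    colour-class : ∀ {A : Set} (f : A → Fin n) m xs → k * m < length xs →
                   ∃ λ ys → ys ⊆ xs × AllPairs (λ x y → f x ≁ f y) ys × m < length ys
    colour-class f m xs km< with pigeonhole k m (All.universal (λ x → col (f x) , refl) xs) km<
    ... | j , ys , s , c , m< = ys , s , same c , m<
      where
      same : ∀ {zs} → All (λ x → col (f x) ≡ j) zs → AllPairs (λ x y → f x ≁ f y) zs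
      same [] = []
      same (e ∷ es) = All.map (same-colour⇒≁ e) es ∷ same es

    Probe : Fin n × Fin n → (Fin n × Fin n) × Fin n → Set
    Probe p₀ (p , z) = (Edge p × Half p₀ p) × z ~ proj₁ p × z ≁ proj₁ p₀

    -- All that an induced matching of the edges from `x` to `z` needs except `z ≁ z′`, which a
    -- colour class supplies.
    Apart : (Fin n × Fin n) × Fin n → (Fin n × Fin n) × Fin n → Set
    Apart ((x , _) , z) ((x′ , _) , z′) = (x ≁ x′ × x ≁ z′) × z ≁ x′

    probe : ∀ {p₀ p} → Edge p₀ → Edge p → Half p₀ p → ∃ λ z → Probe p₀ (p , z)
    probe {x₀ , _} {x , _} e₀ e h
      with separate x x₀ (λ { refl → ~-≁-contra (~-sym e₀) (hyx h) }) (≁-sym (hxx h))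
    ... | z , zx , zx₀ = z , (e , h) , zx , zx₀

    -- `half-graph-obstruction` asks for two common neighbours of `x₀` and `x` that miss `x″`. One
    -- comes from `p`, the other from the skipped pair `q`; this is why every second pair is
    -- dropped.
    skip : ∀ {p₀ p q r} → Edge p₀ → Probe p₀ p → Probe p₀ q → Probe p₀ r →
           Half (proj₁ p) (proj₁ q) → Half (proj₁ p) (proj₁ r) → Half (proj₁ q) (proj₁ r) → Apart p r
    skip {x₀ , _} {(x , _) , z} {_} {(x″ , _) , z″} e₀
      ((e , h) , zx , zx₀) ((e′ , h′) , _) ((_ , h″) , z″x″ , z″x₀) pq pr qr =
      (hxx pr , x≁z″) , far zx₀ zx
      where
      far : ∀ {z} → z ≁ x₀ → z ~ x → z ≁ x″
      far = half-graph-obstruction (hxx h) (hxx h″) (hxx pr)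
        (λ { refl → ~-≁-contra (~-sym e′) (hyx pq) }) (hyy pq) (hxy h) (hxy h′) e (hxy pq) (hyx pr) (hyx qr)
      x≁z″ : x ≁ z″
      x≁z″ with adj? x z″
      ... | inj₂ n = n
      ... | inj₁ a = ⊥-elim (~-≁-contra z″x″ (far z″x₀ (~-sym a)))

    no-long-half-graph : ∀ {p ps} → All Edge (p ∷ ps) → AllPairs Half (p ∷ ps) → length ps ≤ halfGraphLimit k
    no-long-half-graph {x₀ , y₀} (e₀ ∷ es) (h₀ ∷ hs)
      with attach {Q = λ p z → Probe (x₀ , y₀) (p , z)} (All.zipWith (λ (e , h) → probe e₀ e h) (es , h₀)) hs
    ... | qs , refl , ps , hs′ with alternate {T = Apart} (skip e₀) ps hs′
    ...   | rs , s , as , len with k * matchingLimit k <? length rs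
    ...     | no ≮ = ≤-trans (≤-reflexive (length-map proj₁ qs)) (≤-trans len (*-monoʳ-≤ 2 (≮⇒≥ ≮)))
    ...     | yes < with colour-class proj₂ (matchingLimit k) rs <
    ...       | ws , s′ , zz , m< = ⊥-elim (<-asym m< (subst (_< matchingLimit k) (length-map _ ws)
                (matching-short
                  ( All.map⁺ {f = λ { ((x , _) , z) → x , z }}
                      (All.map (λ { (_ , zx , _) → ~-sym zx }) (All-resp-⊆ (⊆-trans s′ s) ps))
                  , AllPairs.map⁺ (AllPairs.zipWith (λ { (((xx , xz) , zx) , zz) → indep xx xz zx zz })
                      (AllPairs-resp-⊆ s′ as , zz))))))

    independent-bounded : ∀ {I} → AllPairs (λ u v → u ≢ v × u ≁ v) I → length I ≤ independentLimit k
    independent-bounded I# = <⇒≤ (≰⇒> λ le → contradictory (staircase (staircaseLength k) I# le))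
      where
      contradictory : ¬ ∃ λ ps → All Edge ps × AllPairs Step ps × All (λ p → proj₁ p ∈ _) ps ×
                                 length ps ≡ staircaseLength k
      contradictory (ps , es , st , _ , len)
        -- One colour makes the second ends independent. Only adjacencies from an earlier `x` to a
        -- later `y` stay open, and Ramsey makes these uniform.
        with colour-class proj₂ (ramseyBound (2 + halfGraphLimit k) (matchingLimit k)) ps (≤-reflexive (sym len))
      ... | qs , s , yy , r<
        with ramsey (λ p q → adj? (proj₁ p) (proj₂ q)) (2 + halfGraphLimit k) (matchingLimit k) qs (<⇒≤ r<)
      ...   | inj₂ (rs , s′ , xy , l) = <⇒≱ (matching-short
              (All-resp-⊆ (⊆-trans s′ s) es ,
               AllPairs.zipWith (λ { (xy , (xx , yx) , yy) → indep xx xy yx yy })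
                 (xy , AllPairs.zip (AllPairs-resp-⊆ (⊆-trans s′ s) st , AllPairs-resp-⊆ s′ yy)))) l
      ...   | inj₁ (p ∷ rs , s′ , xy , l) = <⇒≱ (s≤s⁻¹ l) (no-long-half-graph
              (All-resp-⊆ (⊆-trans s′ s) es)
              (AllPairs.zipWith (λ { (xy , (xx , yx) , yy) → half xx yx yy xy })
                 (xy , AllPairs.zip (AllPairs-resp-⊆ (⊆-trans s′ s) st , AllPairs-resp-⊆ s′ yy))))

    opaque
      unfolding orderLimit

      order-bounded : n ≤ orderLimit k
      order-bounded = ≮⇒≥ λ lt →
        let I , s , I≁ , l = colour-class id (independentLimit k) (allFin n)
                               (subst (orderLimit k <_) (sym (length-tabulate {n = n} id)) lt)
        in <⇒≱ l (independent-bounded (AllPairs.zip (AllPairs-resp-⊆ s (allFin⁺ n) , I≁)))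

-- Recolouring and vertex-criticality.

transpose-injective : ∀ {n} (i j : Fin n) → Injective _≡_ _≡_ (transpose i j)
transpose-injective i j eq = trans (sym (transpose-inverse j i)) (trans (cong (transpose j i) eq) (transpose-inverse j i))

transpose-source : ∀ {n} (i j : Fin n) → transpose i j i ≡ j
transpose-source i j rewrite dec-true (i Fin.≟ i) refl = refl

transpose-other : ∀ {n} {i j k : Fin n} → k ≢ i → k ≢ j → transpose i j k ≡ k
transpose-other {i = i} {j} {k} k≢i k≢j rewrite dec-false (k Fin.≟ i) k≢i | dec-false (k Fin.≟ j) k≢j = refl

-- A transposition corrects the colour of the head; the other elements keep theirs, since both
-- colourings are injective on the list.
rename-colours : ∀ {A : Set} {k} {f g : A → Fin k} {S} →
                 AllPairs (λ x y → f x ≢ f y) S → AllPairs (λ x y → g x ≢ g y) S →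
                 ∃ λ (π : Fin k → Fin k) → Injective _≡_ _≡_ π × All (λ x → π (f x) ≡ g x) S
rename-colours [] [] = id , id , []
rename-colours {f = f} {g} {x ∷ S} (fx ∷ fS) (gx ∷ gS) with rename-colours fS gS
... | π , π-inj , agree =
  transpose (π (f x)) (g x) ∘ π , π-inj ∘ transpose-injective _ _ ,
  transpose-source (π (f x)) (g x) ∷
  All.zipWith (λ (fx≢fy , gx≢gy , eq) → trans
      (transpose-other (λ e → fx≢fy (sym (π-inj e))) (λ e → gx≢gy (trans (sym e) eq))) eq)
    (fx , All.zip (gx , agree))

module Criticality {n} (G : Graph n) (κ : ℕ) (P5-free : Free P5 G) (coP3P2-free : Free coP3P2 G)
  (uncolourable : ¬ Colorable G κ)
  (near-colouring : ∀ v → Σ (Fin n → Fin κ) λ c → ∀ i j → i ≢ v → j ≢ v → adj G i j ≡ true → c i ≢ c j)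
  where

  open Patterns G
  open Structure G P5-free coP3P2-free
  open import Data.List.Membership.DecPropositional (Fin._≟_ {n}) using (_∈?_)

  -- If `v` saw every neighbour of `u`, a colouring of the graph minus `u` would extend by giving
  -- `u` the colour of `v`.
  separate : ∀ u v → u ≢ v → u ≁ v → ∃ λ w → w ~ u × w ≁ v
  separate u v u≢v u≁v with Fin.any? (λ w → w ~? u ×-dec adj G w v Bool.≟ false)
  ... | yes found = found
  ... | no none = ⊥-elim (uncolourable (c′ , proper′))
    where
    c = proj₁ (near-colouring u)
    proper = proj₂ (near-colouring u)
    dominated : ∀ {w} → w ~ u → w ~ v
    dominated {w} wu with adj? w v
    ... | inj₁ wv = wv
    ... | inj₂ w≁v = ⊥-elim (none (w , wu , w≁v))
    c′ : Fin n → Fin κ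
    c′ w with w Fin.≟ u
    ... | yes _ = c v
    ... | no _ = c w
    proper′ : ∀ i j → i ~ j → c′ i ≢ c′ j
    proper′ i j ij with i Fin.≟ u | j Fin.≟ u
    ... | yes refl | yes refl = ⊥-elim (~-irrefl ij)
    ... | yes refl | no j≢u = λ e → proper j v j≢u (u≢v ∘ sym) (dominated (~-sym ij)) (sym e)
    ... | no i≢u | yes refl = proper i v i≢u (u≢v ∘ sym) (dominated ij)
    ... | no i≢u | no j≢u = proper i j i≢u j≢u ij

  -- If no edge left `P` outside `S`, the colouring without `b` on `S` and `P` and the one without
  -- `a` elsewhere, renamed to agree on the clique `S`, would colour the whole graph.
  connected : ∀ S → Clique S → Connected∖ S
  connected S SC {P} P? {a} {b} a∉S Pa b∉S ¬Pb
    with Fin.any? (λ u → Fin.any? λ v → (¬? (u ∈? S) ×-dec ¬? (v ∈? S)) ×-dec (P? u ×-dec ¬? (P? v)) ×-dec u ~? v)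
  ... | yes found = found
  ... | no none = ⊥-elim (uncolourable (c , proper))
    where
    f = proj₁ (near-colouring a)
    g = proj₁ (near-colouring b)
    on-S : ∀ {w} → w ∉ S → AllPairs (λ x y → proj₁ (near-colouring w) x ≢ proj₁ (near-colouring w) y) S
    on-S {w} w∉S = AllPairs-map-∈
      (λ {x} {y} x∈S y∈S → proj₂ (near-colouring w) x y (λ { refl → w∉S x∈S }) (λ { refl → w∉S y∈S })) SC
    recolouring = rename-colours (on-S a∉S) (on-S b∉S)
    π = proj₁ recolouring
    c : Fin n → Fin κ
    c u with u ∈? S | P? u
    ... | yes _ | _     = g u
    ... | no _  | yes _ = g u
    ... | no _  | no _  = π (f u)
    g-proper : ∀ u v → u ~ v → u ∈ S ⊎ P u → v ∈ S ⊎ P v → g u ≢ g v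
    g-proper u v uv iu iv = proj₂ (near-colouring b) u v (≢b iu) (≢b iv) uv
      where
      ≢b : ∀ {u} → u ∈ S ⊎ P u → u ≢ b
      ≢b (inj₁ u∈S) refl = b∉S u∈S
      ≢b (inj₂ Pu)  refl = ¬Pb Pu
    f-proper : ∀ u v → u ~ v → u ∈ S ⊎ ¬ P u → v ∈ S ⊎ ¬ P v → π (f u) ≢ π (f v)
    f-proper u v uv iu iv e = proj₂ (near-colouring a) u v (≢a iu) (≢a iv) uv (proj₁ (proj₂ recolouring) e)
      where
      ≢a : ∀ {u} → u ∈ S ⊎ ¬ P u → u ≢ a
      ≢a (inj₁ u∈S) refl = a∉S u∈S
      ≢a (inj₂ ¬Pu) refl = ¬Pu Pa
    agree : ∀ {u} → u ∈ S → g u ≡ π (f u)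
    agree u∈S = sym (All.lookup (proj₂ (proj₂ recolouring)) u∈S)
    proper : ∀ u v → u ~ v → c u ≢ c v
    proper u v uv with u ∈? S | P? u | v ∈? S | P? v
    ... | yes iu | _     | yes iv | _     = g-proper u v uv (inj₁ iu) (inj₁ iv)
    ... | yes iu | _     | no _   | yes q = g-proper u v uv (inj₁ iu) (inj₂ q)
    ... | yes iu | _     | no _   | no q  = f-proper u v uv (inj₁ iu) (inj₂ q) ∘ trans (sym (agree iu))
    ... | no _   | yes p | yes iv | _     = g-proper u v uv (inj₂ p) (inj₁ iv)
    ... | no _   | no p  | yes iv | _     = λ e → f-proper u v uv (inj₂ p) (inj₁ iv) (trans e (agree iv))
    ... | no _   | yes p | no _   | yes q = g-proper u v uv (inj₂ p) (inj₂ q)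
    ... | no iu  | yes p | no iv  | no q  = ⊥-elim (none (u , v , (iu , iv) , (p , q) , uv))
    ... | no iu  | no p  | no iv  | yes q = ⊥-elim (none (v , u , (iv , iu) , (q , p) , ~-sym uv))
    ... | no _   | no p  | no _   | no q  = f-proper u v uv (inj₂ p) (inj₂ q)

  critical-bounded : Colorable G (suc κ) → n ≤ orderLimit (suc κ)
  critical-bounded (col , proper) = order-bounded col proper connected separate

-- The outer `suc` makes the bound immediate for the graph on one vertex.
order-limit : ∀ {n} κ (G : Graph n) → VertexCritical (suc κ) G → Free P5 G → Free coP3P2 G →
              n ≤ suc (orderLimit (suc κ))
order-limit {zero} κ G _ _ _ = z≤n
order-limit {suc zero} κ G _ _ _ = s≤s z≤n
order-limit {suc (suc n)} κ G ((colourable , least) , critical) P5-free coP3P2-free =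
  m≤n⇒m≤1+n (critical-bounded colourable)
  where
  near : ∀ v → Σ (Fin (suc (suc n)) → Fin κ) λ c → ∀ i j → i ≢ v → j ≢ v → adj G i j ≡ true → c i ≢ c j
  near v with critical v
  ... | m , ((c , proper) , _) , s≤s m≤κ = c′ , proper′
    where
    -- The value at v is junk; a second vertex supplies it, which is why the one-vertex graph is treated apart.
    c′ : Fin (suc (suc n)) → Fin κ
    c′ u with v Fin.≟ u
    ... | yes _  = inject≤ (c zero) m≤κ
    ... | no v≢u = inject≤ (c (punchOut v≢u)) m≤κ
    proper′ : ∀ i j → i ≢ v → j ≢ v → adj G i j ≡ true → c′ i ≢ c′ j
    proper′ i j i≢v j≢v ij with v Fin.≟ i | v Fin.≟ j
    ... | yes e  | _      = ⊥-elim (i≢v (sym e))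
    ... | no _   | yes e  = ⊥-elim (j≢v (sym e))
    ... | no v≢i | no v≢j = proper _ _
          (trans (cong₂ (adj G) (punchIn-punchOut v≢i) (punchIn-punchOut v≢j)) ij)
          ∘ inject≤-injective m≤κ m≤κ _ _
  open Criticality G κ P5-free coP3P2-free (λ colourable → <-irrefl refl (least κ colourable)) near

-- Enumeration of the graphs of bounded order.

fromEdges-adj : ∀ {n} (G : Graph n) {e} → (∀ i j → e i j ≡ adj G i j) → ∀ i j → adj G i j ≡ adj (fromEdges e) i j
fromEdges-adj G e≡ i j with i Fin.≟ j
... | yes refl = adj-irr G i
... | no _ rewrite e≡ i j | e≡ j i | adj-sym G j i = sym (∨-idem _)

fromBool : Bool → Fin 2
fromBool b = Bool.if b then suc zero else zero

toBool : Fin 2 → Bool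
toBool zero = false
toBool (suc zero) = true

toBool-fromBool : ∀ b → toBool (fromBool b) ≡ b
toBool-fromBool true  = refl
toBool-fromBool false = refl

-- The code is an arbitrary Boolean matrix; `fromEdges` symmetrises it and clears the diagonal, so
-- every code yields a graph.
decode : ∀ {n} → Fin ((2 ^ n) ^ n) → Graph n
decode code = fromEdges λ i j → toBool (finToFun (finToFun code i) j)

encode : ∀ {n} → Graph n → Fin ((2 ^ n) ^ n)
encode G = funToFin λ i → funToFin λ j → fromBool (adj G i j)

decode-encode : ∀ {n} (G : Graph n) → Iso G (decode (encode G))
decode-encode G = ↔-id _ , fromEdges-adj G λ i j → trans
  (cong toBool (trans
    (cong (λ row → finToFun row j) (finToFun-funToFin (λ i → funToFin (entry i)) i))
    (finToFun-funToFin (entry i) j)))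
  (toBool-fromBool (adj G i j))
  where
  entry = λ i j → fromBool (adj G i j)

graphs : ℕ → List AnyGraph
graphs n = map (λ code → n , decode code) (allFin _)

∈-graphs : ∀ {n} (G : Graph n) → Any (λ H → Iso G (proj₂ H)) (graphs n)
∈-graphs G = Any.map⁺ (lose (∈-allFin (encode G)) (decode-encode G))

theorem3p4 : (k : ℕ) → 1 ≤ k →
    Σ (List AnyGraph) λ Gs →
    ∀ n (G : Graph n) → VertexCritical k G → Free P5 G → Free coP3P2 G →
    Any (λ H → Iso G (Σ.proj₂ H)) Gs
-- `upTo` excludes its argument, so the largest order listed is `suc (orderLimit (suc κ))`.
theorem3p4 (suc κ) _ = concatMap graphs (upTo (2 + orderLimit (suc κ))) , λ n G critical P5-free coP3P2-free →
  Any.concatMap⁺ graphs (lose (∈-upTo⁺ (s≤s (order-limit κ G critical P5-free coP3P2-free))) (∈-graphs G))
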